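{- Let $K_4$ be the complete $3$-graph on four vertices, i.e. the $3$-graph on vertex set $\{1,2,3,4\}$ with $3$-edges $123,124,134,234$. For every positive integer $n$, $$\frac n2-1\le \mathrm{co^+ex}(n,K_4)\le \frac{2n}{3}.$$
   Context: A $3$-graph is a finite $3$-uniform hypergraph; an edge is written as the concatenation of its vertices. The minimum positive co-degree $\delta_2^+(H)$ of a non-empty $3$-graph $H$ is the maximum $k$ such that every pair of vertices contained in some edge of $H$ is contained in at least $k$ distinct edges of $H$; by convention it is $0$ if $H$ has no edges. A hypergraph is $F$-free if it has no (not necessarily induced) subhypergraph isomorphic to $F$. $\mathrm{co^+ex}(n,F)$ is the maximum of $\delta_2^+(H)$ over all $n$-vertex $F$-free $3$-graphs $H$. -}

module Defs where

open import Data.Bool.Base using (if_then_else_)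
open import Data.Fin.Base using (Fin; zero; suc)
open import Data.Fin.Properties using (any?; all?; suc-injective) renaming (_≟_ to _≟ᶠ_)
open import Data.Fin.Subset using (Subset; inside; outside; ∣_∣; _∈_)
open import Data.Fin.Subset.Properties using (_∈?_)
open import Data.List.Base using (List; []; _∷_; _++_; length; map; filter)
open import Data.List.Extrema.Nat using (max; xs≤max; argmax-sel)
open import Data.List.Membership.Propositional using (find; lose)
  renaming (_∈_ to _∈ˡ_)
open import Data.List.Membership.Propositional.Properties
  using (∈-map⁺; ∈-map⁻; ∈-filter⁺; ∈-filter⁻; ∈-++⁺ˡ; ∈-++⁺ʳ)
open import Data.List.Membership.Propositional.Properties.WithK using (unique∧set⇒bag)
open import Data.List.Properties using (length-filter)
open import Data.List.Relation.Binary.BagAndSetEquality using (∼bag⇒↭)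
open import Data.List.Relation.Binary.Permutation.Propositional.Properties using (↭-length)
open import Data.List.Relation.Binary.Sublist.Propositional using ([]; _∷_; _∷ʳ_)
  renaming (_⊆_ to _⊆ˡ_)
open import Data.List.Relation.Binary.Sublist.Propositional.Properties
  using (All-resp-⊆; filter-⊆)
open import Data.List.Relation.Unary.All using (All; []; _∷_) renaming (lookup to lookupᴬ)
import Data.List.Relation.Unary.All as All
open import Data.List.Relation.Unary.All.Properties using (all-filter)
open import Data.List.Relation.Unary.Any using (Any; here; there)
import Data.List.Relation.Unary.Any as Any
open import Data.List.Relation.Unary.AllPairs using ([]; _∷_)
open import Data.List.Relation.Unary.Unique.Propositional using (Unique)
import Data.List.Relation.Unary.Unique.DecPropositional as DecUnique
import Data.List.Relation.Unary.Unique.Propositional.Properties as Uniqueₚ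
import Data.List.Membership.DecPropositional as DecMembership
open import Data.Nat.Base using (ℕ; zero; suc; _≤_; z≤n; s≤s)
open import Data.Nat.Properties using (_≟_; _≤?_; ≤-trans; m≤n⇒m<n∨m≡n; ≤-pred; n≤0⇒n≡0)
open import Data.Product.Base using (∃; ∃₂; _×_; _,_; proj₁; proj₂)
open import Data.Sum.Base using (inj₁; inj₂)
open import Data.Vec.Base using ([]; _∷_; tabulate; here; there)
open import Data.Vec.Properties using (≡-dec; tabulate-cong; ∷-injectiveʳ)
import Data.Bool.Properties as Bool
import Data.Vec.Functional as Vector
open import Function.Base using (_∘_; _$_)
open import Function.Bundles using (_⇔_; mk⇔; Equivalence)
open import Function.Definitions using (Injective)
open import Relation.Binary.Definitions using (DecidableEquality)
open import Relation.Binary.PropositionalEquality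
  using (_≡_; _≢_; _≗_; refl; sym; trans; cong; cong₂; subst)
open import Relation.Nullary.Decidable
  using (Dec; yes; no; does; map′; ¬?; _×-dec_; _→-dec_; from-yes; does-⇔)
open import Relation.Nullary.Negation using (¬_; contradiction)
open import Relation.Unary using (Decidable)

private
  variable
    m n : ℕ

_≟ˢ_ : DecidableEquality (Subset n)
_≟ˢ_ = ≡-dec Bool._≟_

-- The edge set is given by a duplicate-free list, so that counting
-- entries counts distinct edges; no definition below depends on its order.
record 3Graph (n : ℕ) : Set where
  constructor mk3Graph
  field
    edges    : List (Subset n)
    uniform  : All (λ e → ∣ e ∣ ≡ 3) edges
    distinct : Unique edges

open 3Graph public

K₄ : 3Graph 4
K₄ = record
  { edges    = es
  ; uniform  = from-yes (All.all? (λ e → ∣ e ∣ ≟ 3) es)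
  ; distinct = from-yes (DecUnique.unique? _≟ˢ_ es)
  }
  where
  es : List (Subset 4)
  es = (inside  ∷ inside  ∷ inside  ∷ outside ∷ [])
     ∷ (inside  ∷ inside  ∷ outside ∷ inside  ∷ [])
     ∷ (inside  ∷ outside ∷ inside  ∷ inside  ∷ [])
     ∷ (outside ∷ inside  ∷ inside  ∷ inside  ∷ [])
     ∷ []

IsMaximum : (ℕ → Set) → ℕ → Set
IsMaximum P m = P m × (∀ k → P k → k ≤ m)

-- The largest k ≤ b satisfying the predicate, or 0 if there is none.
largest : {P : ℕ → Set} → Decidable P → ℕ → ℕ
largest P? zero    = 0
largest P? (suc b) = if does (P? (suc b)) then suc b else largest P? b

Contains : Fin n → Fin n → Subset n → Set
Contains x y e = x ∈ e × y ∈ e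

contains? : (x y : Fin n) → Decidable (Contains x y)
contains? x y e = (x ∈? e) ×-dec (y ∈? e)

codegree : 3Graph n → Fin n → Fin n → ℕ
codegree H x y = length (filter (contains? x y) (edges H))

PosCodegree≥ : 3Graph n → ℕ → Set
PosCodegree≥ H k =
  ∀ x y → x ≢ y → Any (Contains x y) (edges H) → k ≤ codegree H x y

posCodegree≥? : (H : 3Graph n) → Decidable (PosCodegree≥ H)
posCodegree≥? H k = all? λ x → all? λ y →
  ¬? (x ≟ᶠ y) →-dec (Any.any? (contains? x y) (edges H) →-dec (k ≤? codegree H x y))

-- If H has an edge then no k above the number of edges is possible, so the
-- bound is harmless (see δ₂⁺-isMaximum); if H has no edges the value is 0.
δ₂⁺ : 3Graph n → ℕ
δ₂⁺ H = largest (posCodegree≥? H) (length (edges H))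

inImage? : (f : Fin m → Fin n) (e : Subset m) → Decidable (λ y → ∃ λ x → x ∈ e × f x ≡ y)
inImage? f e y = any? λ x → (x ∈? e) ×-dec (f x ≟ᶠ y)

image : (Fin m → Fin n) → Subset m → Subset n
image f e = tabulate λ y → does (inImage? f e y)

IsCopy : 3Graph m → 3Graph n → (Fin m → Fin n) → Set
IsCopy F H f = Injective _≡_ _≡_ f × All (λ e → image f e ∈ˡ edges H) (edges F)

Free : 3Graph m → 3Graph n → Set
Free F H = ¬ ∃ (IsCopy F H)

-- Two edge lists presenting the same edge set.
_≈_ : 3Graph n → 3Graph n → Set
G ≈ H = ∀ {e} → e ∈ˡ edges G ⇔ e ∈ˡ edges H

private
  injective? : (f : Fin m → Fin n) → Dec (Injective _≡_ _≡_ f)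
  injective? f = map′ (λ h {x} {y} → h x y) (λ h x y → h {x} {y})
    (all? λ x → all? λ y → (f x ≟ᶠ f y) →-dec (x ≟ᶠ y))

  image-cong : {f g : Fin m → Fin n} → f ≗ g → ∀ e → image f e ≡ image g e
  image-cong f≗g e = tabulate-cong λ y → does-⇔
    (mk⇔ (λ (x , x∈e , p) → x , x∈e , trans (sym (f≗g x)) p)
         (λ (x , x∈e , p) → x , x∈e , trans (f≗g x) p))
    (inImage? _ e y) (inImage? _ e y)

  anyFunction? : {P : (Fin m → Fin n) → Set} → Decidable P →
                 (∀ {f g} → f ≗ g → P f → P g) → Dec (∃ P)
  anyFunction? {zero}  P? resp =
    map′ (Vector.[] ,_) (λ (f , p) → resp (λ ()) p) (P? Vector.[])
  anyFunction? {suc m} P? resp =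
    map′ (λ (y , f , p) → y Vector.∷ f , p)
         (λ (f , p) → f zero , f ∘ suc , resp (λ { zero → refl ; (suc _) → refl }) p)
         (any? λ y → anyFunction? (λ f → P? (y Vector.∷ f))
           λ f≗g → resp λ { zero → refl ; (suc x) → f≗g x })

free? : (F : 3Graph m) → Decidable (Free {n = n} F)
free? F H = ¬? $ anyFunction?
  (λ f → injective? f ×-dec All.all? (λ e → DecMembership._∈?_ _≟ˢ_ (image f e) (edges H)) (edges F))
  (λ f≗g (inj , es) →
    (λ {x} {y} p → inj (trans (f≗g x) (trans p (sym (f≗g y))))) ,
    All.map (λ {e} → subst (_∈ˡ edges H) (image-cong f≗g e)) es)

subsets : ∀ n → List (Subset n)
subsets zero    = [] ∷ []
subsets (suc n) = map (inside ∷_) (subsets n) ++ map (outside ∷_) (subsets n)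

subsets-unique : ∀ n → Unique (subsets n)
subsets-unique zero    = [] ∷ []
subsets-unique (suc n) = Uniqueₚ.++⁺
  (Uniqueₚ.map⁺ ∷-injectiveʳ (subsets-unique n))
  (Uniqueₚ.map⁺ ∷-injectiveʳ (subsets-unique n))
  λ (p , q) → inside≢outside (∈-map⁻ _ p) (∈-map⁻ _ q)
  where
  inside≢outside : ∀ {v} → (∃ λ p → p ∈ˡ subsets n × v ≡ inside ∷ p) →
                   ¬ (∃ λ p → p ∈ˡ subsets n × v ≡ outside ∷ p)
  inside≢outside (_ , _ , refl) (_ , _ , ())

∈-subsets : (e : Subset n) → e ∈ˡ subsets n
∈-subsets []            = here refl
∈-subsets (inside ∷ e)  = ∈-++⁺ˡ (∈-map⁺ _ (∈-subsets e))
∈-subsets (outside ∷ e) = ∈-++⁺ʳ _ (∈-map⁺ _ (∈-subsets e))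

triples : ∀ n → List (Subset n)
triples n = filter (λ e → ∣ e ∣ ≟ 3) (subsets n)

sublists : {A : Set} (xs : List A) → List (∃ (_⊆ˡ xs))
sublists []       = ([] , []) ∷ []
sublists (x ∷ xs) = map (λ (ys , p) → x ∷ ys , refl ∷ p) (sublists xs)
                 ++ map (λ (ys , p) → ys , x ∷ʳ p) (sublists xs)

∈-sublists : {A : Set} {xs ys : List A} (p : ys ⊆ˡ xs) → (ys , p) ∈ˡ sublists xs
∈-sublists []         = here refl
∈-sublists (x ∷ʳ p)   = ∈-++⁺ʳ _ (∈-map⁺ _ (∈-sublists p))
∈-sublists (refl ∷ p) = ∈-++⁺ˡ (∈-map⁺ _ (∈-sublists p))

Unique-resp-⊆ˡ : {A : Set} {xs ys : List A} → ys ⊆ˡ xs → Unique xs → Unique ys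
Unique-resp-⊆ˡ []         []       = []
Unique-resp-⊆ˡ (_ ∷ʳ p)   (_ ∷ u)  = Unique-resp-⊆ˡ p u
Unique-resp-⊆ˡ (refl ∷ p) (x∉ ∷ u) = All-resp-⊆ p x∉ ∷ Unique-resp-⊆ˡ p u

fromSublist : ∃ (_⊆ˡ triples n) → 3Graph n
fromSublist {n} (es , p) = record
  { edges    = es
  ; uniform  = All-resp-⊆ p (all-filter (λ e → ∣ e ∣ ≟ 3) (subsets n))
  ; distinct = Unique-resp-⊆ˡ p (Uniqueₚ.filter⁺ (λ e → ∣ e ∣ ≟ 3) (subsets-unique n))
  }

-- All 3-graphs on Fin n, up to the order of the edge list (see graphs-complete).
graphs : ∀ n → List (3Graph n)
graphs n = map fromSublist (sublists (triples n))

graphs-complete : (H : 3Graph n) → ∃ λ G → G ∈ˡ graphs n × G ≈ H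
graphs-complete {n} H =
  fromSublist (_ , p) , ∈-map⁺ fromSublist (∈-sublists p) , mk⇔
    (λ q → proj₂ (∈-filter⁻ E? {xs = triples n} q))
    (λ q → ∈-filter⁺ E? (∈-filter⁺ (λ e → ∣ e ∣ ≟ 3) (∈-subsets _) (lookupᴬ (uniform H) q)) q)
  where
  E? : Decidable (_∈ˡ edges H)
  E? e = DecMembership._∈?_ _≟ˢ_ e (edges H)

  p : filter E? (triples n) ⊆ˡ triples n
  p = filter-⊆ E? (triples n)

-- The value is 0 if there is no F-free 3-graph on n vertices; otherwise it is
-- the maximum over all of them (see co⁺ex-isMaximum).
co⁺ex : ℕ → 3Graph m → ℕ
co⁺ex n F = max 0 (map δ₂⁺ (filter (free? F) (graphs n)))

largest-upper : {P : ℕ → Set} (P? : Decidable P) {b k : ℕ} → k ≤ b → P k → k ≤ largest P? b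
largest-upper P? {zero}  z≤n _ = z≤n
largest-upper P? {suc b} k≤b p with P? (suc b)
... | yes _ = k≤b
... | no ¬p with m≤n⇒m<n∨m≡n k≤b
...   | inj₁ k<b  = largest-upper P? (≤-pred k<b) p
...   | inj₂ refl = contradiction p ¬p

largest-holds : {P : ℕ → Set} (P? : Decidable P) (b : ℕ) → P 0 → P (largest P? b)
largest-holds P? zero    p₀ = p₀
largest-holds P? (suc b) p₀ with P? (suc b)
... | yes p = p
... | no  _ = largest-holds P? b p₀

largest-cong : {P Q : ℕ → Set} (P? : Decidable P) (Q? : Decidable Q) →
               (∀ k → P k ⇔ Q k) → ∀ b → largest P? b ≡ largest Q? b
largest-cong P? Q? P⇔Q zero    = refl
largest-cong P? Q? P⇔Q (suc b) = cong₂ (λ d r → if d then suc b else r)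
  (does-⇔ (P⇔Q (suc b)) (P? (suc b)) (Q? (suc b)))
  (largest-cong P? Q? P⇔Q b)

private
  1≤∣p∣⇒∃∈ : (p : Subset n) → 1 ≤ ∣ p ∣ → ∃ (_∈ p)
  1≤∣p∣⇒∃∈ (inside  ∷ p) _ = zero , here
  1≤∣p∣⇒∃∈ (outside ∷ p) h = let x , x∈p = 1≤∣p∣⇒∃∈ p h in suc x , there x∈p

  2≤∣p∣⇒∃∈₂ : (p : Subset n) → 2 ≤ ∣ p ∣ → ∃₂ λ x y → x ≢ y × Contains x y p
  2≤∣p∣⇒∃∈₂ (inside  ∷ p) (s≤s h) =
    let x , x∈p = 1≤∣p∣⇒∃∈ p h in zero , suc x , (λ ()) , here , there x∈p
  2≤∣p∣⇒∃∈₂ (outside ∷ p) h =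
    let x , y , x≢y , x∈p , y∈p = 2≤∣p∣⇒∃∈₂ p h
    in suc x , suc y , x≢y ∘ suc-injective , there x∈p , there y∈p

δ₂⁺-isMaximum : (H : 3Graph n) → edges H ≢ [] → IsMaximum (PosCodegree≥ H) (δ₂⁺ H)
δ₂⁺-isMaximum H@(mk3Graph [] _ _) ne = contradiction refl ne
δ₂⁺-isMaximum H@(mk3Graph (e ∷ es) (∣e∣≡3 ∷ _) _) _ =
  largest-holds (posCodegree≥? H) _ (λ _ _ _ _ → z≤n) , λ k p →
  let x , y , x≢y , xy∈e = 2≤∣p∣⇒∃∈₂ e (subst (2 ≤_) (sym ∣e∣≡3) (s≤s (s≤s z≤n)))
  in largest-upper (posCodegree≥? H)
       (≤-trans (p x y x≢y (here xy∈e)) (length-filter (contains? x y) (e ∷ es))) p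

private
  length-cong : {A : Set} {xs ys : List A} → Unique xs → Unique ys →
                (∀ {x} → x ∈ˡ xs ⇔ x ∈ˡ ys) → length xs ≡ length ys
  length-cong u v eq = ↭-length (∼bag⇒↭ (unique∧set⇒bag u v eq))

≈-sym : {G H : 3Graph n} → G ≈ H → H ≈ G
≈-sym eq = mk⇔ (Equivalence.from eq) (Equivalence.to eq)

codegree-cong : (G H : 3Graph n) → G ≈ H → ∀ x y → codegree G x y ≡ codegree H x y
codegree-cong G H eq x y = length-cong
  (Uniqueₚ.filter⁺ (contains? x y) (distinct G)) (Uniqueₚ.filter⁺ (contains? x y) (distinct H))
  (mk⇔ (go G H (Equivalence.to eq)) (go H G (Equivalence.from eq)))
  where
  go : ∀ G H → (∀ {e} → e ∈ˡ edges G → e ∈ˡ edges H) → ∀ {e} →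
       e ∈ˡ filter (contains? x y) (edges G) → e ∈ˡ filter (contains? x y) (edges H)
  go G H to p = let q , xy∈e = ∈-filter⁻ (contains? x y) {xs = edges G} p
                in ∈-filter⁺ (contains? x y) (to q) xy∈e

δ₂⁺-cong : (G H : 3Graph n) → G ≈ H → δ₂⁺ G ≡ δ₂⁺ H
δ₂⁺-cong G H eq = trans
  (largest-cong (posCodegree≥? G) (posCodegree≥? H)
    (λ k → mk⇔ (go G H eq) (go H G (≈-sym {G = G} {H = H} eq)))
    (length (edges G)))
  (cong (largest (posCodegree≥? H)) (length-cong (distinct G) (distinct H) eq))
  where
  go : ∀ G H → G ≈ H → ∀ {k} → PosCodegree≥ G k → PosCodegree≥ H k
  go G H eq p x y x≢y cov with find cov
  ... | e , e∈H , xy∈e =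
    subst (_ ≤_) (codegree-cong G H eq x y) (p x y x≢y (lose (Equivalence.from eq e∈H) xy∈e))

free-cong : (F : 3Graph m) (G H : 3Graph n) → G ≈ H → Free F H → Free F G
free-cong F G H eq free (f , inj , es) = free (f , inj , All.map (Equivalence.to eq) es)

co⁺ex-upper : (F : 3Graph m) (H : 3Graph n) → Free F H → δ₂⁺ H ≤ co⁺ex n F
co⁺ex-upper {n = n} F H free =
  let G , G∈ , G≈H = graphs-complete H
  in subst (_≤ co⁺ex n F) (δ₂⁺-cong G H G≈H)
       (lookupᴬ (xs≤max 0 _) (∈-map⁺ δ₂⁺ (∈-filter⁺ (free? F) G∈ (free-cong F G H G≈H free))))

co⁺ex-isMaximum : (F : 3Graph m) → ∃ (Free {n = n} F) →
                  IsMaximum (λ k → ∃ λ (H : 3Graph n) → Free F H × δ₂⁺ H ≡ k) (co⁺ex n F)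
co⁺ex-isMaximum {n = n} F (H , free) = attained , λ { _ (G , G-free , refl) → co⁺ex-upper F G G-free }
  where
  δs : List ℕ
  δs = map δ₂⁺ (filter (free? F) (graphs n))

  attained : ∃ λ (H : 3Graph n) → Free F H × δ₂⁺ H ≡ co⁺ex n F
  attained with argmax-sel (λ k → k) 0 δs
  ... | inj₁ eq = H , free , trans (n≤0⇒n≡0 (subst (δ₂⁺ H ≤_) eq (co⁺ex-upper F H free))) (sym eq)
  ... | inj₂ k∈ with ∈-map⁻ δ₂⁺ k∈
  ...   | G , G∈ , eq = G , proj₂ (∈-filter⁻ (free? F) {xs = graphs n} G∈) , sym eq

{-# OPTIONS --safe #-}
-- Lower bound: split the vertex set evenly into A and B and take all triples with
-- exactly two vertices in A.  Two vertices of A have codegree |B|, a vertex of A and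
-- one of B have codegree |A| − 1, and no edge contains two vertices of B.  In a copy of
-- K₄ any two vertices would lie on the same side, and then no triple is an edge.
-- Upper bound: if abc is an edge and the minimum positive codegree exceeds 2n/3, then the
-- neighbourhoods of the pairs ab, ac and bc have a common vertex v, and a, b, c, v span K₄.
module Submission where

open import Defs
open import Data.Nat.Base as ℕ using (ℕ; NonZero)
open import Data.Integer.Base using (+_)
open import Data.Rational.Base using (_/_; _-_; _≤_; 1ℚ)
open import Data.Product.Base using (_×_)

open import Data.Fin.Base using (Fin; zero; suc)
open import Data.Fin.Patterns using (0F; 1F; 2F; 3F)
open import Data.Fin.Subset using (Subset; inside; outside; ∣_∣; _∈_; _∉_; _⊆_; _∪_; _∩_; ∁; ⁅_⁆; ⊤; ⊥)
open import Data.Fin.Subset.Properties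
import Data.Integer.Base as ℤ
import Data.Integer.Properties as ℤₚ
open import Data.List.Base using (List; []; _∷_; map; filter; length; allFin; tabulate)
open import Data.List.Membership.Propositional using (find; lose) renaming (_∈_ to _∈ˡ_)
import Data.List.Membership.DecPropositional as DecMembership
open import Data.List.Membership.Propositional.Properties
  using (∈-map⁺; ∈-map⁻; ∈-filter⁺; ∈-filter⁻; ∈-allFin)
open import Data.List.Membership.Propositional.Properties.WithK using (unique∧set⇒bag)
open import Data.List.Properties using (length-map)
open import Data.List.Relation.Binary.BagAndSetEquality using (∼bag⇒↭)
open import Data.List.Relation.Binary.Permutation.Propositional.Properties using (↭-length)
open import Data.List.Relation.Unary.All using (All; []; _∷_) renaming (lookup to lookupᴬ)
import Data.List.Relation.Unary.All as All
open import Data.List.Relation.Unary.All.Properties using (all-filter)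
open import Data.List.Relation.Unary.AllPairs using ([]; _∷_)
open import Data.List.Relation.Unary.Any using (here)
open import Data.List.Relation.Unary.Unique.Propositional using (Unique)
import Data.List.Relation.Unary.Unique.Propositional.Properties as Uniqueₚ
open import Data.Nat.Base using (zero; suc; s≤s; z≤n; _+_; _*_; ⌊_/2⌋; ⌈_/2⌉)
open import Data.Nat.Properties hiding (_≤?_)
open import Data.Nat.Tactic.RingSolver using (solve-∀)
open import Data.Product.Base using (∃; ∃₂; _,_; proj₁; proj₂)
import Data.Rational.Base as ℚ
import Data.Rational.Properties as ℚₚ
open import Data.Rational.Unnormalised.Base as ℚᵘ using (mkℚᵘ; 1ℚᵘ)
import Data.Rational.Unnormalised.Properties as ℚᵘₚ
open import Data.Sum.Base using (inj₁; inj₂)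
import Data.Vec.Base as Vec
open import Data.Vec.Base using ([]; _∷_; here; there)
open import Data.Vec.Properties using (lookup∘tabulate; lookup⇒[]=; []=⇒lookup)
open import Function.Base using (_∘_; id)
open import Function.Bundles using (_⇔_; mk⇔; Equivalence)
open import Function.Definitions using (Injective)
open import Level using (0ℓ)
open import Relation.Binary.PropositionalEquality
open import Relation.Nullary.Decidable using (does; yes; no; dec-true; _×-dec_)
open import Relation.Nullary.Negation using (¬_; contradiction)
open import Relation.Unary using (Pred; Decidable)

private
  variable
    m n : ℕ
    x y z : Fin n
    p q : Subset n

-- Cardinalities of finite subsets.

∈-tabulate-does : {P : Pred (Fin n) 0ℓ} (P? : Decidable P) → x ∈ Vec.tabulate (does ∘ P?) ⇔ P x
∈-tabulate-does {x = x} P? = mk⇔ to from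
  where
  to : _
  to x∈ with P? x | trans (sym (lookup∘tabulate (does ∘ P?) x)) ([]=⇒lookup x∈)
  ... | yes px | _  = px
  ... | no  _  | ()

  from : _
  from px = lookup⇒[]= x _ (trans (lookup∘tabulate (does ∘ P?) x) (dec-true (P? x) px))

-- Induction on `p` alongside `f`; a general `f` is needed because the tail is tabulated by
-- `f ∘ suc`.
length-filter-tabulate : {A : Set} {P : Pred A 0ℓ} (P? : Decidable P) (f : Fin n → A) (p : Subset n) →
                         (∀ x → x ∈ p ⇔ P (f x)) → length (filter P? (tabulate f)) ≡ ∣ p ∣
length-filter-tabulate P? f [] _ = refl
length-filter-tabulate {P = P} P? f (b ∷ p) eq = step b (eq zero)
  where
  tail : length (filter P? (tabulate (f ∘ suc))) ≡ ∣ p ∣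
  tail = length-filter-tabulate P? (f ∘ suc) p λ x →
    mk⇔ (Equivalence.to (eq (suc x)) ∘ there) (drop-there ∘ Equivalence.from (eq (suc x)))

  step : ∀ b → zero ∈ b ∷ p ⇔ P (f zero) →
         length (filter P? (tabulate f)) ≡ ∣ b ∷ p ∣
  step _ _ with P? (f zero)
  step inside  _   | yes _  = cong suc tail
  step outside eq₀ | yes px = contradiction (Equivalence.from eq₀ px) λ ()
  step inside  eq₀ | no ¬px = contradiction (Equivalence.to eq₀ here) ¬px
  step outside _   | no  _  = tail

∣p∣≢0⇒nonempty : (p : Subset n) → ∣ p ∣ ≢ 0 → ∃ (_∈ p)
∣p∣≢0⇒nonempty {n} p ∣p∣≢0 with nonempty? p
... | yes ne = ne
... | no  ¬ne = contradiction (trans (cong ∣_∣ (Empty-unique ¬ne)) (∣⊥∣≡0 n)) ∣p∣≢0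

∣p∣≡0⇒p≡⊥ : {p : Subset n} → ∣ p ∣ ≡ 0 → p ≡ ⊥
∣p∣≡0⇒p≡⊥ {p = p} ∣p∣≡0 = Empty-unique λ (x , x∈p) →
  <⇒≱ (x∈p⇒∣p-x∣<∣p∣ x∈p) (≤-trans (≤-reflexive ∣p∣≡0) z≤n)

-- Inclusion-exclusion with the union bounded by `n`, checked coordinate by coordinate.
∣p∣+∣q∣≤n+∣p∩q∣ : (p q : Subset n) → ∣ p ∣ + ∣ q ∣ ℕ.≤ n + ∣ p ∩ q ∣
∣p∣+∣q∣≤n+∣p∩q∣ []            []            = z≤n
∣p∣+∣q∣≤n+∣p∩q∣ (inside  ∷ p) (inside  ∷ q) =
  s≤s (subst₂ ℕ._≤_ (sym (+-suc ∣ p ∣ ∣ q ∣)) (sym (+-suc _ ∣ p ∩ q ∣)) (s≤s (∣p∣+∣q∣≤n+∣p∩q∣ p q)))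
∣p∣+∣q∣≤n+∣p∩q∣ (inside  ∷ p) (outside ∷ q) = s≤s (∣p∣+∣q∣≤n+∣p∩q∣ p q)
∣p∣+∣q∣≤n+∣p∩q∣ {suc n} (outside ∷ p) (inside  ∷ q) =
  subst (ℕ._≤ suc n + ∣ p ∩ q ∣) (sym (+-suc ∣ p ∣ ∣ q ∣)) (s≤s (∣p∣+∣q∣≤n+∣p∩q∣ p q))
∣p∣+∣q∣≤n+∣p∩q∣ (outside ∷ p) (outside ∷ q) = m≤n⇒m≤1+n (∣p∣+∣q∣≤n+∣p∩q∣ p q)

∣⁅x⁆∪p∣≤1+∣p∣ : (x : Fin n) (p : Subset n) → ∣ ⁅ x ⁆ ∪ p ∣ ℕ.≤ suc ∣ p ∣
∣⁅x⁆∪p∣≤1+∣p∣ zero    (b ∷ p) =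
  s≤s (subst (ℕ._≤ ∣ b ∷ p ∣) (cong ∣_∣ (sym (∪-identityˡ p))) (∣p∣≤∣x∷p∣ b p))
∣⁅x⁆∪p∣≤1+∣p∣ (suc x) (inside  ∷ p) = s≤s (∣⁅x⁆∪p∣≤1+∣p∣ x p)
∣⁅x⁆∪p∣≤1+∣p∣ (suc x) (outside ∷ p) = ∣⁅x⁆∪p∣≤1+∣p∣ x p

x∈p⇒⁅x⁆∪p≡p : x ∈ p → ⁅ x ⁆ ∪ p ≡ p
x∈p⇒⁅x⁆∪p≡p here          = cong (inside ∷_) (∪-identityˡ _)
x∈p⇒⁅x⁆∪p≡p (there x∈p) = cong (_ ∷_) (x∈p⇒⁅x⁆∪p≡p x∈p)

x∈p⇒p≡⁅x⁆∪q : x ∈ p → ∃ λ q → x ∉ q × p ≡ ⁅ x ⁆ ∪ q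
x∈p⇒p≡⁅x⁆∪q (here {xs = p}) = outside ∷ p , (λ ()) , cong (inside ∷_) (sym (∪-identityˡ p))
x∈p⇒p≡⁅x⁆∪q (there {y = b} x∈p) =
  let q , x∉q , eq = x∈p⇒p≡⁅x⁆∪q x∈p in b ∷ q , x∉q ∘ drop-there , cong (b ∷_) eq

-- Disjoint additivity. Iterated, it splits the trace of a triple on `A` into contributions of its
-- vertices; `A = ⊤` yields plain cardinalities.
∣[⁅x⁆∪p]∩A∣ : {p : Subset n} (A : Subset n) → x ∉ p → ∣ (⁅ x ⁆ ∪ p) ∩ A ∣ ≡ ∣ ⁅ x ⁆ ∩ A ∣ + ∣ p ∩ A ∣
∣[⁅x⁆∪p]∩A∣ {x = zero}  {p = inside ∷ p} A x∉p = contradiction here x∉p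
∣[⁅x⁆∪p]∩A∣ {suc n} {x = zero}  {p = outside ∷ p} (inside ∷ A) _
  rewrite ∪-identityˡ p | ∩-zeroˡ A | ∣⊥∣≡0 n = refl
∣[⁅x⁆∪p]∩A∣ {suc n} {x = zero}  {p = outside ∷ p} (outside ∷ A) _
  rewrite ∪-identityˡ p | ∩-zeroˡ A | ∣⊥∣≡0 n = refl
∣[⁅x⁆∪p]∩A∣ {x = suc x} {p = outside ∷ p} (_ ∷ A) x∉p = ∣[⁅x⁆∪p]∩A∣ A (x∉p ∘ there)
∣[⁅x⁆∪p]∩A∣ {x = suc x} {p = inside ∷ p} (outside ∷ A) x∉p = ∣[⁅x⁆∪p]∩A∣ A (x∉p ∘ there)
∣[⁅x⁆∪p]∩A∣ {x = suc x} {p = inside ∷ p} (inside ∷ A) x∉p =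
  trans (cong suc (∣[⁅x⁆∪p]∩A∣ A (x∉p ∘ there))) (sym (+-suc _ _))

x∉p⇒∣⁅x⁆∪p∣≡1+∣p∣ : x ∉ p → ∣ ⁅ x ⁆ ∪ p ∣ ≡ suc ∣ p ∣
x∉p⇒∣⁅x⁆∪p∣≡1+∣p∣ {x = x} {p = p} x∉p = begin
  ∣ ⁅ x ⁆ ∪ p ∣                    ≡⟨ cong ∣_∣ (∩-identityʳ (⁅ x ⁆ ∪ p)) ⟨
  ∣ (⁅ x ⁆ ∪ p) ∩ ⊤ ∣              ≡⟨ ∣[⁅x⁆∪p]∩A∣ ⊤ x∉p ⟩
  (∣ ⁅ x ⁆ ∩ ⊤ ∣) + (∣ p ∩ ⊤ ∣)    ≡⟨ cong₂ (λ a b → (∣ a ∣) + (∣ b ∣)) (∩-identityʳ ⁅ x ⁆) (∩-identityʳ p) ⟩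
  (∣ ⁅ x ⁆ ∣) + (∣ p ∣)            ≡⟨ cong (_+ ∣ p ∣) (∣⁅x⁆∣≡1 x) ⟩
  suc ∣ p ∣                        ∎
  where open ≡-Reasoning

x∈A⇒∣⁅x⁆∩A∣≡1 : x ∈ p → ∣ ⁅ x ⁆ ∩ p ∣ ≡ 1
x∈A⇒∣⁅x⁆∩A∣≡1 {suc n} (here {xs = p}) rewrite ∩-zeroˡ p = cong suc (∣⊥∣≡0 n)
x∈A⇒∣⁅x⁆∩A∣≡1 (there x∈p) = x∈A⇒∣⁅x⁆∩A∣≡1 x∈p

x∉A⇒∣⁅x⁆∩A∣≡0 : x ∉ p → ∣ ⁅ x ⁆ ∩ p ∣ ≡ 0
x∉A⇒∣⁅x⁆∩A∣≡0 {x = zero}  {p = inside  ∷ p} x∉p = contradiction here x∉p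
x∉A⇒∣⁅x⁆∩A∣≡0 {suc n} {x = zero}  {p = outside ∷ p} x∉p rewrite ∩-zeroˡ p = ∣⊥∣≡0 n
x∉A⇒∣⁅x⁆∩A∣≡0 {x = suc x} {p = _ ∷ p} x∉p = x∉A⇒∣⁅x⁆∩A∣≡0 (x∉p ∘ there)

-- Three-element sets as triples of vertices.

triple : Fin n → Fin n → Fin n → Subset n
triple x y z = ⁅ x ⁆ ∪ (⁅ y ⁆ ∪ ⁅ z ⁆)

Distinct : Fin n → Fin n → Fin n → Set
Distinct x y z = x ≢ y × x ≢ z × y ≢ z

x∉⁅y⁆∪⁅z⁆ : x ≢ y → x ≢ z → x ∉ ⁅ y ⁆ ∪ ⁅ z ⁆
x∉⁅y⁆∪⁅z⁆ {y = y} {z = z} x≢y x≢z x∈ with x∈p∪q⁻ ⁅ y ⁆ ⁅ z ⁆ x∈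
... | inj₁ x∈⁅y⁆ = x≢y (x∈⁅y⁆⇒x≡y y x∈⁅y⁆)
... | inj₂ x∈⁅z⁆ = x≢z (x∈⁅y⁆⇒x≡y z x∈⁅z⁆)

∣triple∣≡3 : Distinct x y z → ∣ triple x y z ∣ ≡ 3
∣triple∣≡3 {z = z} (x≢y , x≢z , y≢z) = trans (x∉p⇒∣⁅x⁆∪p∣≡1+∣p∣ (x∉⁅y⁆∪⁅z⁆ x≢y x≢z))
  (cong suc (trans (x∉p⇒∣⁅x⁆∪p∣≡1+∣p∣ (x≢y⇒x∉⁅y⁆ y≢z)) (cong suc (∣⁅x⁆∣≡1 z))))

∣triple∩A∣ : (A : Subset n) → Distinct x y z →
             ∣ triple x y z ∩ A ∣ ≡ ∣ ⁅ x ⁆ ∩ A ∣ + (∣ ⁅ y ⁆ ∩ A ∣ + ∣ ⁅ z ⁆ ∩ A ∣)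
∣triple∩A∣ A (x≢y , x≢z , y≢z) = trans (∣[⁅x⁆∪p]∩A∣ A (x∉⁅y⁆∪⁅z⁆ x≢y x≢z))
  (cong (_ ℕ.+_) (∣[⁅x⁆∪p]∩A∣ A (x≢y⇒x∉⁅y⁆ y≢z)))

∣⁅x⁆∪⁅y⁆∣≤2 : (x y : Fin n) → ∣ ⁅ x ⁆ ∪ ⁅ y ⁆ ∣ ℕ.≤ 2
∣⁅x⁆∪⁅y⁆∣≤2 x y = ≤-trans (∣⁅x⁆∪p∣≤1+∣p∣ x ⁅ y ⁆) (s≤s (≤-reflexive (∣⁅x⁆∣≡1 y)))

-- Any coincidence among the three vertices collapses the union to at most two elements.
∣triple∣≡3⇒distinct : ∣ triple x y z ∣ ≡ 3 → Distinct x y z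
∣triple∣≡3⇒distinct {x = x} {y} {z} ∣t∣≡3 =
  (λ { refl → small (p⊆p∪q ⁅ z ⁆ (x∈⁅x⁆ x)) }) ,
  (λ { refl → small (q⊆p∪q ⁅ y ⁆ ⁅ z ⁆ (x∈⁅x⁆ x)) }) ,
  (λ { refl → <-irrefl ∣t∣≡3 (s≤s (≤-trans (∣⁅x⁆∪p∣≤1+∣p∣ x _)
                (s≤s (≤-reflexive (trans (cong ∣_∣ (∪-idem ⁅ y ⁆)) (∣⁅x⁆∣≡1 y)))))) })
  where
  small : ¬ (x ∈ ⁅ y ⁆ ∪ ⁅ z ⁆)
  small x∈ = <-irrefl (trans (cong ∣_∣ (sym (x∈p⇒⁅x⁆∪p≡p x∈))) ∣t∣≡3) (s≤s (∣⁅x⁆∪⁅y⁆∣≤2 y z))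

x∈triple : (x y z : Fin n) → x ∈ triple x y z
x∈triple x y z = p⊆p∪q _ (x∈⁅x⁆ x)

y∈triple : (x y z : Fin n) → y ∈ triple x y z
y∈triple x y z = q⊆p∪q ⁅ x ⁆ _ (p⊆p∪q _ (x∈⁅x⁆ y))

z∈triple : (x y z : Fin n) → z ∈ triple x y z
z∈triple x y z = q⊆p∪q ⁅ x ⁆ _ (q⊆p∪q ⁅ y ⁆ _ (x∈⁅x⁆ z))

-- The vertex `z` lies in the second triple and differs from `x` and `y`, which leaves only `z′`.
triple-injective : Distinct x y z → {z′ : Fin n} → triple x y z ≡ triple x y z′ → z ≡ z′
triple-injective {x = x} {y} {z} (x≢y , x≢z , y≢z) {z′} eq
  with x∈p∪q⁻ ⁅ x ⁆ (⁅ y ⁆ ∪ ⁅ z′ ⁆) (subst (z ∈_) eq (z∈triple x y z))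
... | inj₁ z∈ = contradiction (sym (x∈⁅y⁆⇒x≡y x z∈)) x≢z
... | inj₂ z∈ with x∈p∪q⁻ ⁅ y ⁆ ⁅ z′ ⁆ z∈
...   | inj₁ z∈ = contradiction (sym (x∈⁅y⁆⇒x≡y y z∈)) y≢z
...   | inj₂ z∈ = x∈⁅y⁆⇒x≡y z′ z∈

∣p∣≡1⇒p≡⁅x⁆ : {p : Subset n} → ∣ p ∣ ≡ 1 → ∃ λ x → p ≡ ⁅ x ⁆
∣p∣≡1⇒p≡⁅x⁆ {p = p} ∣p∣≡1 =
  let x , x∈p        = ∣p∣≢0⇒nonempty p (λ ∣p∣≡0 → contradiction (trans (sym ∣p∣≡1) ∣p∣≡0) λ ())
      q , x∉q , p≡ = x∈p⇒p≡⁅x⁆∪q x∈p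
      ∣q∣≡0 = suc-injective (trans (sym (trans (cong ∣_∣ p≡) (x∉p⇒∣⁅x⁆∪p∣≡1+∣p∣ x∉q))) ∣p∣≡1)
  in x , trans p≡ (trans (cong (⁅ x ⁆ ∪_) (∣p∣≡0⇒p≡⊥ ∣q∣≡0)) (∪-identityʳ ⁅ x ⁆))

-- Remove `x`, then `y`, which survives the first removal because `x ≢ y`; a single element remains.
complete-triple : {e : Subset n} → ∣ e ∣ ≡ 3 → x ≢ y → Contains x y e → ∃ λ z → e ≡ triple x y z
complete-triple {x = x} {y} ∣e∣≡3 x≢y (x∈e , y∈e) with x∈p⇒p≡⁅x⁆∪q x∈e
... | q , x∉q , refl with x∈p∪q⁻ ⁅ x ⁆ q y∈e
...   | inj₁ y∈⁅x⁆ = contradiction (sym (x∈⁅y⁆⇒x≡y x y∈⁅x⁆)) x≢y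
...   | inj₂ y∈q with x∈p⇒p≡⁅x⁆∪q y∈q
...     | r , y∉r , refl =
  let ∣q∣≡2 = suc-injective (trans (sym (x∉p⇒∣⁅x⁆∪p∣≡1+∣p∣ x∉q)) ∣e∣≡3)
      z , r≡ = ∣p∣≡1⇒p≡⁅x⁆ (suc-injective (trans (sym (x∉p⇒∣⁅x⁆∪p∣≡1+∣p∣ y∉r)) ∣q∣≡2))
  in z , cong (λ r → ⁅ x ⁆ ∪ (⁅ y ⁆ ∪ r)) r≡

∣e∣≡3⇒e≡triple : {e : Subset n} → ∣ e ∣ ≡ 3 → ∃₂ λ x y → ∃ λ z → e ≡ triple x y z
∣e∣≡3⇒e≡triple {e = e} ∣e∣≡3 with ∣p∣≢0⇒nonempty e (λ ∣e∣≡0 → contradiction (trans (sym ∣e∣≡3) ∣e∣≡0) λ ())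
... | x , x∈e with x∈p⇒p≡⁅x⁆∪q x∈e
...   | q , x∉q , refl with suc-injective (trans (sym (x∉p⇒∣⁅x⁆∪p∣≡1+∣p∣ x∉q)) ∣e∣≡3)
...     | ∣q∣≡2 with ∣p∣≢0⇒nonempty q (λ ∣q∣≡0 → contradiction (trans (sym ∣q∣≡2) ∣q∣≡0) λ ())
...       | y , y∈q = x , y , complete-triple ∣e∣≡3 (λ { refl → x∉q y∈q }) (x∈e , q⊆p∪q ⁅ x ⁆ q y∈q)

-- Neighbourhoods of pairs and codegrees.

module _ (H : 3Graph n) where

  private
    _∈edges? : Decidable (_∈ˡ edges H)
    e ∈edges? = DecMembership._∈?_ _≟ˢ_ e (edges H)

  edge-distinct : triple x y z ∈ˡ edges H → Distinct x y z
  edge-distinct t∈ = ∣triple∣≡3⇒distinct (lookupᴬ (uniform H) t∈)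

  neighbours : Fin n → Fin n → Subset n
  neighbours x y = Vec.tabulate λ z → does (triple x y z ∈edges?)

  ∈-neighbours : z ∈ neighbours x y ⇔ triple x y z ∈ˡ edges H
  ∈-neighbours {x = x} {y} = ∈-tabulate-does (λ z → triple x y z ∈edges?)

  -- The map sending `z` to `triple x y z` matches neighbours with the edges through `x` and `y`.
  -- Both lists are duplicate-free with the same members, hence permutations of each other.
  codegree≡∣neighbours∣ : x ≢ y → codegree H x y ≡ ∣ neighbours x y ∣
  codegree≡∣neighbours∣ {x = x} {y} x≢y = begin
    length (filter (contains? x y) (edges H)) ≡⟨ ↭-length (∼bag⇒↭ (unique∧set⇒bag
                                                   (Uniqueₚ.filter⁺ (contains? x y) (distinct H))
                                                   (unique-map (Uniqueₚ.filter⁺ completes? (Uniqueₚ.allFin⁺ n))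
                                                     (all-filter completes? (allFin n)))
                                                   (mk⇔ to from))) ⟩
    length (map (triple x y) zs)              ≡⟨ length-map (triple x y) zs ⟩
    length zs                                 ≡⟨ length-filter-tabulate completes? id (neighbours x y) (λ _ → ∈-neighbours) ⟩
    ∣ neighbours x y ∣                        ∎
    where
    open ≡-Reasoning

    completes? : Decidable (λ z → triple x y z ∈ˡ edges H)
    completes? z = triple x y z ∈edges?

    zs : List (Fin n)
    zs = filter completes? (allFin n)

    -- `triple x y` is not injective on all vertices, since `z = x` and `z = y` give the same set;
    -- it is injective on those `z` that complete an edge.
    unique-map : ∀ {zs} → Unique zs → All (λ z → triple x y z ∈ˡ edges H) zs → Unique (map (triple x y) zs)
    unique-map []       []       = []
    unique-map (z∉ ∷ u) (t∈ ∷ ts) = go z∉ ∷ unique-map u ts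
      where
      go : ∀ {zs} → All (_ ≢_) zs → All (triple x y _ ≢_) (map (triple x y) zs)
      go []         = []
      go (z≢ ∷ z∉) = (z≢ ∘ triple-injective (edge-distinct t∈)) ∷ go z∉

    to : ∀ {e} → e ∈ˡ filter (contains? x y) (edges H) → e ∈ˡ map (triple x y) zs
    to e∈ with ∈-filter⁻ (contains? x y) {xs = edges H} e∈
    ... | e∈H , xy∈e with complete-triple (lookupᴬ (uniform H) e∈H) x≢y xy∈e
    ...   | z , refl = ∈-map⁺ (triple x y) (∈-filter⁺ completes? (∈-allFin z) e∈H)

    from : ∀ {e} → e ∈ˡ map (triple x y) zs → e ∈ˡ filter (contains? x y) (edges H)
    from e∈ with ∈-map⁻ (triple x y) e∈
    ... | z , z∈ , refl = ∈-filter⁺ (contains? x y)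
      (proj₂ (∈-filter⁻ completes? {xs = allFin n} z∈)) (x∈triple x y z , y∈triple x y z)

-- Images of subsets and of triples.

∈-image : (f : Fin m → Fin n) (e : Subset m) → y ∈ image f e ⇔ ∃ λ x → x ∈ e × f x ≡ y
∈-image f e = ∈-tabulate-does (inImage? f e)

image-∪ : (f : Fin m → Fin n) (p q : Subset m) → image f (p ∪ q) ≡ image f p ∪ image f q
image-∪ f p q = ⊆-antisym to from
  where
  to : image f (p ∪ q) ⊆ image f p ∪ image f q
  to y∈ with Equivalence.to (∈-image f (p ∪ q)) y∈
  ... | x , x∈ , fx≡y with x∈p∪q⁻ p q x∈
  ...   | inj₁ x∈p = p⊆p∪q _ (Equivalence.from (∈-image f p) (x , x∈p , fx≡y))
  ...   | inj₂ x∈q = q⊆p∪q (image f p) _ (Equivalence.from (∈-image f q) (x , x∈q , fx≡y))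

  from : image f p ∪ image f q ⊆ image f (p ∪ q)
  from y∈ with x∈p∪q⁻ (image f p) (image f q) y∈
  ... | inj₁ y∈p = let x , x∈p , eq = Equivalence.to (∈-image f p) y∈p
                   in Equivalence.from (∈-image f (p ∪ q)) (x , p⊆p∪q q x∈p , eq)
  ... | inj₂ y∈q = let x , x∈q , eq = Equivalence.to (∈-image f q) y∈q
                   in Equivalence.from (∈-image f (p ∪ q)) (x , q⊆p∪q p q x∈q , eq)

image-⁅⁆ : (f : Fin m → Fin n) (x : Fin m) → image f ⁅ x ⁆ ≡ ⁅ f x ⁆
image-⁅⁆ f x = ⊆-antisym to from
  where
  to : image f ⁅ x ⁆ ⊆ ⁅ f x ⁆
  to y∈ with Equivalence.to (∈-image f ⁅ x ⁆) y∈
  ... | x′ , x′∈ , refl rewrite x∈⁅y⁆⇒x≡y x x′∈ = x∈⁅x⁆ (f x)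

  from : ⁅ f x ⁆ ⊆ image f ⁅ x ⁆
  from y∈ = Equivalence.from (∈-image f ⁅ x ⁆) (x , x∈⁅x⁆ x , sym (x∈⁅y⁆⇒x≡y (f x) y∈))

image-triple : (f : Fin m → Fin n) (x y z : Fin m) → image f (triple x y z) ≡ triple (f x) (f y) (f z)
image-triple f x y z = trans (image-∪ f ⁅ x ⁆ (⁅ y ⁆ ∪ ⁅ z ⁆))
  (cong₂ _∪_ (image-⁅⁆ f x) (trans (image-∪ f ⁅ y ⁆ ⁅ z ⁆) (cong₂ _∪_ (image-⁅⁆ f y) (image-⁅⁆ f z))))

-- Upper bound

-- Edges have three elements, so the given triples already force `a`, `b`, `c`, `v` to be pairwise
-- distinct.
K₄-copy : (H : 3Graph n) {a b c v : Fin n} →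
          triple a b c ∈ˡ edges H → triple a b v ∈ˡ edges H →
          triple a c v ∈ˡ edges H → triple b c v ∈ˡ edges H → ∃ (IsCopy K₄ H)
K₄-copy H {a} {b} {c} {v} abc abv acv bcv = f , injective ,
  -- On concrete indices `triple` computes to the literal bit vectors listed as edges of `K₄`.
  subst (_∈ˡ edges H) (sym (image-triple f 0F 1F 2F)) abc ∷
  subst (_∈ˡ edges H) (sym (image-triple f 0F 1F 3F)) abv ∷
  subst (_∈ˡ edges H) (sym (image-triple f 0F 2F 3F)) acv ∷
  subst (_∈ˡ edges H) (sym (image-triple f 1F 2F 3F)) bcv ∷ []
  where
  f : Fin 4 → Fin _
  f = Vec.lookup (a ∷ b ∷ c ∷ v ∷ [])

  a≢b = proj₁ (edge-distinct H abc)
  a≢c = proj₁ (proj₂ (edge-distinct H abc))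
  b≢c = proj₂ (proj₂ (edge-distinct H abc))
  a≢v = proj₁ (proj₂ (edge-distinct H abv))
  b≢v = proj₂ (proj₂ (edge-distinct H abv))
  c≢v = proj₂ (proj₂ (edge-distinct H acv))

  injective : Injective _≡_ _≡_ f
  injective {0F} {0F} _  = refl
  injective {0F} {1F} eq = contradiction eq a≢b
  injective {0F} {2F} eq = contradiction eq a≢c
  injective {0F} {3F} eq = contradiction eq a≢v
  injective {1F} {0F} eq = contradiction (sym eq) a≢b
  injective {1F} {1F} _  = refl
  injective {1F} {2F} eq = contradiction eq b≢c
  injective {1F} {3F} eq = contradiction eq b≢v
  injective {2F} {0F} eq = contradiction (sym eq) a≢c
  injective {2F} {1F} eq = contradiction (sym eq) b≢c
  injective {2F} {2F} _  = refl
  injective {2F} {3F} eq = contradiction eq c≢v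
  injective {3F} {0F} eq = contradiction (sym eq) a≢v
  injective {3F} {1F} eq = contradiction (sym eq) b≢v
  injective {3F} {2F} eq = contradiction (sym eq) c≢v
  injective {3F} {3F} _  = refl

-- Two uses of the intersection bound show that the three sizes sum to at most `2 * n` plus the size
-- of the triple intersection.
common-element : (p q r : Subset n) → 2 * n ℕ.< ∣ p ∣ + ∣ q ∣ + ∣ r ∣ → ∃ λ x → x ∈ p × x ∈ q × x ∈ r
common-element {n} p q r 2n< =
  let x , x∈     = ∣p∣≢0⇒nonempty ((p ∩ q) ∩ r) nonzero
      x∈pq , x∈r = x∈p∩q⁻ (p ∩ q) r x∈
      x∈p , x∈q  = x∈p∩q⁻ p q x∈pq
  in x , x∈p , x∈q , x∈r
  where
  open ≤-Reasoning

  nonzero : ∣ (p ∩ q) ∩ r ∣ ≢ 0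
  nonzero eq = n≮n (2 * n) (begin-strict
    2 * n                            <⟨ 2n< ⟩
    (∣ p ∣) + (∣ q ∣) + (∣ r ∣)      ≤⟨ +-monoˡ-≤ ∣ r ∣ (∣p∣+∣q∣≤n+∣p∩q∣ p q) ⟩
    n + (∣ p ∩ q ∣) + (∣ r ∣)        ≡⟨ +-assoc n _ _ ⟩
    n + ((∣ p ∩ q ∣) + (∣ r ∣))      ≤⟨ +-monoʳ-≤ n (∣p∣+∣q∣≤n+∣p∩q∣ (p ∩ q) r) ⟩
    n + (n + ∣ (p ∩ q) ∩ r ∣)        ≡⟨ cong (λ k → n + (n + k)) eq ⟩
    2 * n                            ∎)

δ₂⁺-upper : (H : 3Graph n) → Free K₄ H → δ₂⁺ H * 3 ℕ.≤ 2 * n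
-- Without edges the codegree is `0` by convention.
δ₂⁺-upper (mk3Graph [] _ _) _ = z≤n
δ₂⁺-upper {n} H@(mk3Graph (e ∷ es) (∣e∣≡3 ∷ _) _) free = ≮⇒≥ λ 2n<3δ →
  let a , b , c , e≡      = ∣e∣≡3⇒e≡triple ∣e∣≡3
      abc                 = here (sym e≡)
      a≢b , a≢c , b≢c     = edge-distinct H abc
      -- Any two vertices of `abc` form a covered pair, so their neighbourhood has at least `δ`
      -- elements.
      δ≤ : ∀ {x y} → x ≢ y → x ∈ triple a b c → y ∈ triple a b c → δ ℕ.≤ ∣ neighbours H x y ∣
      δ≤ x≢y x∈ y∈        = subst (δ ℕ.≤_) (codegree≡∣neighbours∣ H x≢y)
                              (proj₁ (δ₂⁺-isMaximum H λ ()) _ _ x≢y (lose abc (x∈ , y∈)))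
      v , v∈ab , v∈ac , v∈bc = common-element (neighbours H a b) (neighbours H a c) (neighbours H b c)
        (<-≤-trans 2n<3δ (≤-trans (≤-reflexive (δ*3≡ δ))
          (+-mono-≤ (+-mono-≤ (δ≤ a≢b (x∈triple a b c) (y∈triple a b c))
                              (δ≤ a≢c (x∈triple a b c) (z∈triple a b c)))
                    (δ≤ b≢c (y∈triple a b c) (z∈triple a b c)))))
  in free (K₄-copy H abc (Equivalence.to (∈-neighbours H) v∈ab)
            (Equivalence.to (∈-neighbours H) v∈ac) (Equivalence.to (∈-neighbours H) v∈bc))
  where
  δ = δ₂⁺ H

  δ*3≡ : ∀ d → d * 3 ≡ d + d + d
  δ*3≡ = solve-∀

empty : 3Graph n
empty = mk3Graph [] [] []

co⁺ex-upper-bound : ∀ n → co⁺ex n K₄ * 3 ℕ.≤ 2 * n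
co⁺ex-upper-bound n =
  -- The maximum is attained because some `K₄`-free graph exists, namely the edgeless one.
  let H , free , eq = proj₁ (co⁺ex-isMaximum {n = n} K₄ (empty , λ { (_ , _ , () ∷ _) }))
  in subst (λ k → k * 3 ℕ.≤ 2 * n) eq (δ₂⁺-upper H free)

-- Lower bound

module _ (A : Subset n) where

  private
    isEdge? : Decidable (λ e → ∣ e ∣ ≡ 3 × ∣ e ∩ A ∣ ≡ 2)
    isEdge? e = (∣ e ∣ ≟ 3) ×-dec (∣ e ∩ A ∣ ≟ 2)

    -- The indicator function of `A`, written as a cardinality so that `∣triple∩A∣` applies: a
    -- triple of distinct vertices is an edge exactly when its weights sum to 2.
    weight : Fin n → ℕ
    weight x = ∣ ⁅ x ⁆ ∩ A ∣

  splitGraph : 3Graph n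
  splitGraph = record
    { edges    = filter isEdge? (subsets n)
    ; uniform  = All.map proj₁ (all-filter isEdge? (subsets n))
    ; distinct = Uniqueₚ.filter⁺ isEdge? (subsets-unique n)
    }

  ∈-splitGraph⁺ : Distinct x y z → weight x + (weight y + weight z) ≡ 2 → triple x y z ∈ˡ edges splitGraph
  ∈-splitGraph⁺ d w≡2 = ∈-filter⁺ isEdge? (∈-subsets _) (∣triple∣≡3 d , trans (∣triple∩A∣ A d) w≡2)

  ∈-splitGraph⁻ : triple x y z ∈ˡ edges splitGraph → weight x + (weight y + weight z) ≡ 2
  ∈-splitGraph⁻ t∈ = trans (sym (∣triple∩A∣ A (edge-distinct splitGraph t∈)))
    (proj₂ (proj₂ (∈-filter⁻ isEdge? {xs = subsets n} t∈)))

  -- Two edges sharing two vertices have equal weight on their remaining vertices. Hence vertices 0,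
  -- 1 and 2 of a copy share one weight `w`, and their edge would give `3w = 2`.
  splitGraph-K₄-free : Free K₄ splitGraph
  splitGraph-K₄-free (f , _ , 012∈ ∷ 013∈ ∷ 023∈ ∷ 123∈ ∷ []) =
    absurd (weight (f 0F)) (subst₂ (λ a b → weight (f 0F) + (a + b) ≡ 2) (sym w₀≡w₁) (sym w₀≡w₂) (edge 0F 1F 2F 012∈))
    where
    edge : ∀ i j k → image f (triple i j k) ∈ˡ edges splitGraph →
           weight (f i) + (weight (f j) + weight (f k)) ≡ 2
    edge i j k t∈ = ∈-splitGraph⁻ (subst (_∈ˡ edges splitGraph) (image-triple f i j k) t∈)

    w₀≡w₁ : weight (f 0F) ≡ weight (f 1F)
    w₀≡w₁ = +-cancelʳ-≡ _ _ _ (trans (edge 0F 2F 3F 023∈) (sym (edge 1F 2F 3F 123∈)))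

    w₁≡w₂ : weight (f 1F) ≡ weight (f 2F)
    w₁≡w₂ = +-cancelʳ-≡ _ _ _ (+-cancelˡ-≡ (weight (f 0F)) _ _ (trans (edge 0F 1F 3F 013∈) (sym (edge 0F 2F 3F 023∈))))

    w₀≡w₂ : weight (f 0F) ≡ weight (f 2F)
    w₀≡w₂ = trans w₀≡w₁ w₁≡w₂

    absurd : ∀ w → w + (w + w) ≢ 2
    absurd 0             ()
    absurd 1             ()
    absurd (suc (suc w)) eq =
      contradiction (m+n≡0⇒n≡0 w (suc-injective (suc-injective eq))) λ ()

  module _ {k : ℕ} (k<∣A∣ : k ℕ.< ∣ A ∣) (k≤∣∁A∣ : k ℕ.≤ ∣ ∁ A ∣) where

    private
      k≤∣A∖x∣ : x ∈ A → ∃ λ q → x ∉ q × q ⊆ A × k ℕ.≤ ∣ q ∣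
      k≤∣A∖x∣ {x = x} x∈A with x∈p⇒p≡⁅x⁆∪q x∈A
      ... | q , x∉q , A≡ = q , x∉q , subst (q ⊆_) (sym A≡) (q⊆p∪q ⁅ x ⁆ q) ,
        ℕ.s≤s⁻¹ (subst (k ℕ.<_) (trans (cong ∣_∣ A≡) (x∉p⇒∣⁅x⁆∪p∣≡1+∣p∣ x∉q)) k<∣A∣)

      ∈∧∉⇒≢ : x ∈ p → y ∉ p → x ≢ y
      ∈∧∉⇒≢ x∈p y∉p refl = y∉p x∈p

    -- A pair inside `A` is completed by all of `∁ A`; a crossing pair is completed by `A` without
    -- its own vertex there, which is why `k` must be strictly below `∣ A ∣`.
    splitGraph-codegree : PosCodegree≥ splitGraph k
    splitGraph-codegree x y x≢y covered with find covered
    ... | e , e∈ , xy∈e with complete-triple (lookupᴬ (uniform splitGraph) e∈) x≢y xy∈e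
    ...   | z , refl = subst (k ℕ.≤_) (sym (codegree≡∣neighbours∣ splitGraph x≢y)) bound
      where
      -- It suffices to exhibit a set of at least `k` vertices, each completing the pair to an edge.
      through : {q : Subset n} → k ℕ.≤ ∣ q ∣ →
                (∀ {v} → v ∈ q → x ≢ v × y ≢ v × weight x + (weight y + weight v) ≡ 2) →
                k ℕ.≤ ∣ neighbours splitGraph x y ∣
      through k≤∣q∣ h = ≤-trans k≤∣q∣ (p⊆q⇒∣p∣≤∣q∣ λ v∈q →
        let x≢v , y≢v , w≡2 = h v∈q
        in Equivalence.from (∈-neighbours splitGraph) (∈-splitGraph⁺ (x≢y , x≢v , y≢v) w≡2))

      bound : k ℕ.≤ ∣ neighbours splitGraph x y ∣
      bound with x ∈? A | y ∈? A
      ... | yes x∈A | yes y∈A = through k≤∣∁A∣ λ v∈∁A →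
        let v∉A = x∈∁p⇒x∉p v∈∁A
        in ∈∧∉⇒≢ x∈A v∉A , ∈∧∉⇒≢ y∈A v∉A ,
           cong₂ _+_ (x∈A⇒∣⁅x⁆∩A∣≡1 x∈A) (cong₂ _+_ (x∈A⇒∣⁅x⁆∩A∣≡1 y∈A) (x∉A⇒∣⁅x⁆∩A∣≡0 v∉A))
      ... | yes x∈A | no y∉A = let q , x∉q , q⊆A , k≤∣q∣ = k≤∣A∖x∣ x∈A in through k≤∣q∣ λ v∈q →
        ≢-sym (∈∧∉⇒≢ v∈q x∉q) , ≢-sym (∈∧∉⇒≢ (q⊆A v∈q) y∉A) ,
        cong₂ _+_ (x∈A⇒∣⁅x⁆∩A∣≡1 x∈A) (cong₂ _+_ (x∉A⇒∣⁅x⁆∩A∣≡0 y∉A) (x∈A⇒∣⁅x⁆∩A∣≡1 (q⊆A v∈q)))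
      ... | no x∉A | yes y∈A = let q , y∉q , q⊆A , k≤∣q∣ = k≤∣A∖x∣ y∈A in through k≤∣q∣ λ v∈q →
        ≢-sym (∈∧∉⇒≢ (q⊆A v∈q) x∉A) , ≢-sym (∈∧∉⇒≢ v∈q y∉q) ,
        cong₂ _+_ (x∉A⇒∣⁅x⁆∩A∣≡0 x∉A) (cong₂ _+_ (x∈A⇒∣⁅x⁆∩A∣≡1 y∈A) (x∈A⇒∣⁅x⁆∩A∣≡1 (q⊆A v∈q)))
      -- A pair outside `A` is in no edge: the third vertex would need weight 2, but weights are at
      -- most 1.
      ... | no x∉A | no y∉A = contradiction
        (trans (sym (cong₂ _+_ (x∉A⇒∣⁅x⁆∩A∣≡0 x∉A) (cong (_+ weight z) (x∉A⇒∣⁅x⁆∩A∣≡0 y∉A)))) (∈-splitGraph⁻ e∈))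
        (weight≢2 z)
        where
        weight≢2 : ∀ z → weight z ≢ 2
        weight≢2 z eq = <-irrefl eq (s≤s (≤-trans (∣p∩q∣≤∣p∣ ⁅ z ⁆ A) (≤-reflexive (∣⁅x⁆∣≡1 z))))

    -- For positive `k` there are two vertices in `A` and one outside, and these form an edge.
    splitGraph-nonempty : k ≢ 0 → edges splitGraph ≢ []
    splitGraph-nonempty k≢0 ≡[] =
      let x , x∈A = ∣p∣≢0⇒nonempty A (m<n⇒n≢0 k<∣A∣)
          q , x∉q , q⊆A , k≤∣q∣ = k≤∣A∖x∣ x∈A
          y , y∈q = ∣p∣≢0⇒nonempty q (λ eq → k≢0 (n≤0⇒n≡0 (subst (k ℕ.≤_) eq k≤∣q∣)))
          z , z∈∁A = ∣p∣≢0⇒nonempty (∁ A) (λ eq → k≢0 (n≤0⇒n≡0 (subst (k ℕ.≤_) eq k≤∣∁A∣)))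
          z∉A = x∈∁p⇒x∉p z∈∁A
      in contradiction
           (subst (triple x y z ∈ˡ_) ≡[] (∈-splitGraph⁺ (≢-sym (∈∧∉⇒≢ y∈q x∉q) , ∈∧∉⇒≢ x∈A z∉A , ∈∧∉⇒≢ (q⊆A y∈q) z∉A)
             (cong₂ _+_ (x∈A⇒∣⁅x⁆∩A∣≡1 x∈A) (cong₂ _+_ (x∈A⇒∣⁅x⁆∩A∣≡1 (q⊆A y∈q)) (x∉A⇒∣⁅x⁆∩A∣≡0 z∉A)))))
           λ ()

    k≤δ₂⁺-splitGraph : k ℕ.≤ δ₂⁺ splitGraph
    -- The maximality of `δ₂⁺` is available only for graphs with an edge, so `k = 0` is settled
    -- separately.
    k≤δ₂⁺-splitGraph with k ≟ 0
    ... | yes refl = z≤n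
    ... | no  k≢0  = proj₂ (δ₂⁺-isMaximum splitGraph (splitGraph-nonempty k≢0)) k splitGraph-codegree

-- Complementing at each step puts every second vertex in the set. The two side sizes then follow
-- the same recursion as the rounded halves of `n`.
alternating : ∀ n → Subset n
alternating zero    = []
alternating (suc n) = inside ∷ ∁ (alternating n)

∣alternating∣ : ∀ n → ∣ alternating n ∣ ≡ ⌈ n /2⌉ × ∣ ∁ (alternating n) ∣ ≡ ⌊ n /2⌋
∣alternating∣ zero = refl , refl
∣alternating∣ (suc n) =
  let eq , ∁eq = ∣alternating∣ n
  in cong suc ∁eq , trans (cong ∣_∣ (∁-involutive (alternating n))) eq
  where
  ∁-involutive : ∀ {n} (p : Subset n) → ∁ (∁ p) ≡ p
  ∁-involutive []            = refl
  ∁-involutive (inside  ∷ p) = cong (inside ∷_) (∁-involutive p)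
  ∁-involutive (outside ∷ p) = cong (outside ∷_) (∁-involutive p)

-- On `suc n` vertices `A` takes the larger half, of size `⌊ n /2⌋ + 1`, since crossing pairs lose
-- one vertex of it; the other side has `⌈ n /2⌉` vertices.
⌊n/2⌋≤co⁺ex : ∀ n → ⌊ n /2⌋ ℕ.≤ co⁺ex (suc n) K₄
⌊n/2⌋≤co⁺ex n = ≤-trans
  (k≤δ₂⁺-splitGraph A (≤-reflexive (sym ∣A∣)) (≤-trans (⌊n/2⌋≤⌈n/2⌉ n) (≤-reflexive (sym ∣∁A∣))))
  (co⁺ex-upper K₄ (splitGraph A) (splitGraph-K₄-free A))
  where
  A    = alternating (suc n)
  ∣A∣  = proj₁ (∣alternating∣ (suc n))
  ∣∁A∣ = proj₂ (∣alternating∣ (suc n))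

1+n≤[⌊n/2⌋+1]*2 : ∀ n → suc n ℕ.≤ (⌊ n /2⌋ + 1) * 2
1+n≤[⌊n/2⌋+1]*2 zero          = s≤s z≤n
1+n≤[⌊n/2⌋+1]*2 (suc zero)    = s≤s (s≤s z≤n)
1+n≤[⌊n/2⌋+1]*2 (suc (suc n)) = s≤s (s≤s (1+n≤[⌊n/2⌋+1]*2 n))

co⁺ex-lower-bound : ∀ n → .{{_ : NonZero n}} → n ℕ.≤ (co⁺ex n K₄ + 1) * 2
co⁺ex-lower-bound (suc n) = ≤-trans (1+n≤[⌊n/2⌋+1]*2 n) (*-monoˡ-≤ 2 (+-monoˡ-≤ 1 (⌊n/2⌋≤co⁺ex n)))

-- Passage from natural-number bounds to rational ones.

/-mono-≤ : ∀ a b c d → a * suc d ℕ.≤ c * suc b → + a / suc b ≤ + c / suc d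
/-mono-≤ a b c d h = ℚₚ.toℚᵘ-cancel-≤ (begin
  -- `_/_` reduces fractions, so the comparison is made by cross-multiplying unnormalised
  -- representatives.
  ℚ.toℚᵘ (+ a / suc b) ≃⟨ ℚₚ.toℚᵘ-fromℚᵘ (mkℚᵘ (+ a) b) ⟩
  mkℚᵘ (+ a) b                          ≤⟨ ℚᵘ.*≤* (subst₂ ℤ._≤_ (ℤₚ.pos-* a (suc d)) (ℤₚ.pos-* c (suc b)) (ℤ.+≤+ h)) ⟩
  mkℚᵘ (+ c) d                          ≃⟨ ℚₚ.toℚᵘ-fromℚᵘ (mkℚᵘ (+ c) d) ⟨
  ℚ.toℚᵘ (+ c / suc d) ∎)
  where open ℚᵘₚ.≤-Reasoning

[n+1]/1≡n/1+1 : ∀ n → + (n + 1) / 1 ≡ + n / 1 ℚ.+ 1ℚ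
[n+1]/1≡n/1+1 n = ℚₚ.toℚᵘ-injective (begin
  ℚ.toℚᵘ (+ (n + 1) / 1)       ≈⟨ ℚₚ.toℚᵘ-fromℚᵘ (mkℚᵘ (+ (n + 1)) 0) ⟩
  -- The factor 1 introduced here matches the numerator produced by unnormalised addition.
  mkℚᵘ (+ (n + 1)) 0           ≈⟨ ℚᵘ.*≡* (cong (λ k → + (k + 1) ℤ.* ℤ.1ℤ) (sym (*-identityʳ n))) ⟩
  mkℚᵘ (+ (n * 1 + 1)) 0       ≈⟨ ℚᵘ.*≡* (cong (λ k → (k ℤ.+ ℤ.1ℤ) ℤ.* ℤ.1ℤ) (ℤₚ.pos-* n 1)) ⟩
  mkℚᵘ (+ n) 0 ℚᵘ.+ 1ℚᵘ        ≈⟨ ℚᵘₚ.+-congˡ 1ℚᵘ (ℚₚ.toℚᵘ-fromℚᵘ (mkℚᵘ (+ n) 0)) ⟨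
  ℚ.toℚᵘ (+ n / 1) ℚᵘ.+ 1ℚᵘ    ≈⟨ ℚₚ.toℚᵘ-homo-+ (+ n / 1) 1ℚ ⟨
  ℚ.toℚᵘ (+ n / 1 ℚ.+ 1ℚ)      ∎)
  where open import Relation.Binary.Reasoning.Setoid ℚᵘₚ.≃-setoid

n/2-1≤c/1 : ∀ n c → n ℕ.≤ (c + 1) * 2 → (+ n / 2) - 1ℚ ≤ + c / 1
n/2-1≤c/1 n c n≤ = begin
  (+ n / 2) - 1ℚ             ≤⟨ ℚₚ.+-monoˡ-≤ (ℚ.- 1ℚ) (/-mono-≤ n 1 (c + 1) 0 (≤-trans (≤-reflexive (*-identityʳ n)) n≤)) ⟩
  + (c + 1) / 1 - 1ℚ         ≡⟨ cong (_- 1ℚ) ([n+1]/1≡n/1+1 c) ⟩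
  (+ c / 1 ℚ.+ 1ℚ) - 1ℚ      ≡⟨ ℚₚ.+-assoc (+ c / 1) 1ℚ (ℚ.- 1ℚ) ⟩
  + c / 1 ℚ.+ (1ℚ - 1ℚ)      ≡⟨ ℚₚ.+-identityʳ (+ c / 1) ⟩
  + c / 1                    ∎
  where open ℚₚ.≤-Reasoning

theorem11 : (n : ℕ) → .{{_ : NonZero n}} →
    ((+ n / 2) - 1ℚ ≤ + co⁺ex n K₄ / 1) ×
    (+ co⁺ex n K₄ / 1 ≤ + (2 ℕ.* n) / 3)
theorem11 n =
  n/2-1≤c/1 n (co⁺ex n K₄) (co⁺ex-lower-bound n) ,
  -- The arguments `0` and `2` encode the denominators 1 and 3.
  /-mono-≤ (co⁺ex n K₄) 0 (2 * n) 2 (≤-trans (co⁺ex-upper-bound n) (≤-reflexive (sym (*-identityʳ (2 * n)))))
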